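{- Let $\mathcal X_1,\mathcal X_2$ be finite sets of secret input values, let $\mathcal W_1,\mathcal W_2$ be sets of guesses, let $g_1:\mathcal W_1\times\mathcal X_1\to[0,1]$ and $g_2:\mathcal W_2\times\mathcal X_2\to[0,1]$ be gain functions, and let $g:(\mathcal W_1\times\mathcal W_2)\times(\mathcal X_1\times\mathcal X_2)\to[0,1]$ be a joint gain function for $g_1,g_2$. For any prior $\pi$ on $\mathcal X_1\times\mathcal X_2$, with marginals $\pi_1,\pi_2$, $$H_g(\pi)\ \ge\ H_{g_1}(\pi_1)+H_{g_2}(\pi_2)+\log M^{\min}_{g,\pi}.$$
   Context: A prior on a finite set $\mathcal X$ is a probability distribution on $\mathcal X$. For a set $\mathcal W$ of guesses and a gain function $g:\mathcal W\times\mathcal X\to[0,1]$, the prior $g$-vulnerability is $V_g(\pi)=\max_{w\in\mathcal W}\sum_{x\in\mathcal X}\pi[x]g(w,x)$ and the $g$-entropy is $H_g(\pi)=-\log V_g(\pi)$. For the joint gain function, the guess set is $\mathcal W_1\times\mathcal W_2$ and the secret set is $\mathcal X_1\times\mathcal X_2$. Logarithms are to base 2. A joint gain function $g$ for $g_1,g_2$ is required to satisfy: $g((w_1,w_2),(x_1,x_2))=0$ if and only if $g_1(w_1,x_1)g_2(w_2,x_2)=0$ (no other relation is assumed). The marginals of $\pi$ are $\pi_1[x_1]=\sum_{x_2\in\mathcal X_2}\pi[x_1,x_2]$ and $\pi_2[x_2]=\sum_{x_1\in\mathcal X_1}\pi[x_1,x_2]$. For $w_1\in\mathcal W_1,w_2\in\mathcal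 W_2$ let $\mathcal S_{w_1,w_2}=\{(x_1,x_2)\in\mathcal X_1\times\mathcal X_2:\pi[x_1,x_2]\cdot g((w_1,w_2),(x_1,x_2))\ne0\}$, and define $$M^{\min}_{g,\pi}=\min_{w_1\in\mathcal W_1,\,w_2\in\mathcal W_2}\ \min_{(x_1,x_2)\in\mathcal S_{w_1,w_2}}\frac{\pi_1[x_1]g_1(w_1,x_1)\cdot\pi_2[x_2]g_2(w_2,x_2)}{\pi[x_1,x_2]\cdot g((w_1,w_2),(x_1,x_2))}.$$ -}

module Defs where

open import Algebra.Bundles using (CommutativeRing; Semiring)
import Algebra.Definitions.RawSemiring as RawSemiringDefs
open import Data.Fin.Base using (Fin)
open import Data.Fin.Properties using (*↔×)
open import Data.List.Base using (List; map; filter; tabulate)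
import Data.List.Extrema as Extrema
open import Data.Nat.Base using (ℕ; suc)
import Data.Nat.Base as ℕ
open import Data.Product.Base using (_×_; _,_; ∃; ∃-syntax; proj₁; proj₂)
open import Data.Product.Function.NonDependent.Propositional using (_×-↔_)
open import Function.Base using (flip)
open import Function.Bundles using (_↔_; _⇔_; Inverse)
open import Function.Construct.Composition using (_↔-∘_)
open import Level using (Level; _⊔_) renaming (suc to lsuc)
open import Relation.Binary.Bundles using (TotalOrder)
open import Relation.Binary.Core using (Rel)
import Relation.Binary.Construct.Add.Extrema.NonStrict as AddExtrema
open import Relation.Binary.Structures using (IsDecTotalOrder)
open import Relation.Nullary.Construct.Add.Extrema using (_±; ⊥±; ⊤±; [_])
open import Relation.Nullary.Decidable using (yes; no; ¬?)
open import Relation.Nullary.Negation using (¬_)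
open import Relation.Unary using (Pred; Satisfiable; Decidable)

private
  variable
    a ℓ w x : Level

------------------------------------------------------------------------
-- Finite sets

record Finite (X : Set x) : Set x where
  field
    size        : ℕ
    enumeration : Fin size ↔ X

  element : Fin size → X
  element = Inverse.to enumeration

  elements : List X
  elements = tabulate element

_×-finite_ : {X₁ X₂ : Set x} → Finite X₁ → Finite X₂ → Finite (X₁ × X₂)
F₁ ×-finite F₂ = record
  { size        = size F₁ ℕ.* size F₂
  ; enumeration = (enumeration F₁ ×-↔ enumeration F₂) ↔-∘ *↔×
  } where open Finite

------------------------------------------------------------------------
-- Attained maxima and minima

-- max_{i ∈ I} f i.  The index set may be infinite, so the existence of the
-- maximum is data: an index at which it is attained (hence I is inhabited).
record Maximum {A : Set a} (_≤_ : Rel A ℓ) {I : Set w} (f : I → A) :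
               Set (a ⊔ ℓ ⊔ w) where
  field
    argmax  : I
    maximal : ∀ i → f i ≤ f argmax

  value : A
  value = f argmax

Minimum : {A : Set a} (_≤_ : Rel A ℓ) {I : Set w} (f : I → A) → Set (a ⊔ ℓ ⊔ w)
Minimum _≤_ = Maximum (flip _≤_)

------------------------------------------------------------------------
-- The real numbers

-- The standard library has no reals.  A Dedekind-complete ordered field is
-- determined up to unique isomorphism, so ℝ is specified here by exactly
-- those axioms, read classically: the order is decidable, and every inhabited
-- bounded-above predicate has a least upper bound.
record RealNumbers (c ℓ : Level) : Set (lsuc (c ⊔ ℓ)) where
  infix  4 _≤_
  infix  8 _⁻¹
  field
    commutativeRing : CommutativeRing c ℓ

  open CommutativeRing commutativeRing public

  field
    _≤_             : Rel Carrier ℓ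
    isDecTotalOrder : IsDecTotalOrder _≈_ _≤_
    +-monoˡ-≤       : ∀ {x y} z → x ≤ y → x + z ≤ y + z
    *-nonNeg        : ∀ {x y} → 0# ≤ x → 0# ≤ y → 0# ≤ x * y
    0≉1             : ¬ 0# ≈ 1#
    -- total, with an unspecified value at 0
    _⁻¹             : Carrier → Carrier
    *-inverseʳ      : ∀ {x} → ¬ x ≈ 0# → x * x ⁻¹ ≈ 1#

  IsUpperBound : Pred Carrier ℓ → Carrier → Set (c ⊔ ℓ)
  IsUpperBound P u = ∀ y → P y → y ≤ u

  field
    -- total, with an unspecified value outside the hypotheses of these laws
    sup       : Pred Carrier ℓ → Carrier
    sup-upper : ∀ P → Satisfiable P → ∃ (IsUpperBound P) →
                IsUpperBound P (sup P)
    sup-least : ∀ P → Satisfiable P → ∃ (IsUpperBound P) →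
                ∀ u → IsUpperBound P u → sup P ≤ u

  open IsDecTotalOrder isDecTotalOrder public
    using (isTotalOrder; _≟_; _≤?_)

------------------------------------------------------------------------
-- g-entropy over the reals

module Entropy {c ℓ} (ℛ : RealNumbers c ℓ) where

  open RealNumbers ℛ
  open RawSemiringDefs (Semiring.rawSemiring semiring)
    using (_^_; sum) renaming (_×_ to _·_)
  open AddExtrema _≤_ using (≤±-isTotalOrder)
  open AddExtrema _≤_ public using (_≤±_)

  infix 7 _÷_

  _÷_ : Carrier → Carrier → Carrier
  p ÷ q = p * q ⁻¹

  -- log₂ r, for r > 0, is the supremum of the rationals y = (m - n) / (1 + k)
  -- with 2 ^ y ≤ r, that is with 2 ^ m ≤ 2 ^ n * r ^ (1 + k).
  log₂ : Carrier → Carrier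
  log₂ r = sup λ y → ∃[ m ] ∃[ n ] ∃[ k ]
    (suc k · y + n · 1# ≈ m · 1#) × (2# ^ m ≤ 2# ^ n * r ^ suc k)
    where
    2# : Carrier
    2# = 1# + 1#

  ----------------------------------------------------------------------
  -- Extended reals

  -- Only nonnegative arguments matter; log₂ 0 = -∞.
  log± : Carrier ± → Carrier ±
  log± ⊥±    = ⊥±
  log± ⊤±    = ⊤±
  log± [ r ] with r ≤? 0#
  ... | yes _ = ⊥±
  ... | no  _ = [ log₂ r ]

  -±_ : Carrier ± → Carrier ±
  -± ⊥±    = ⊤±
  -± ⊤±    = ⊥±
  -± [ r ] = [ - r ]

  infixl 6 _+±_

  -- +∞ absorbs -∞.  No such sum arises below: vulnerabilities are at most 1
  -- and the ratios in M-min are positive, so no summand there is -∞.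
  _+±_ : Carrier ± → Carrier ± → Carrier ±
  ⊤±    +± _     = ⊤±
  ⊥±    +± ⊤±    = ⊤±
  [ _ ] +± ⊤±    = ⊤±
  ⊥±    +± ⊥±    = ⊥±
  ⊥±    +± [ _ ] = ⊥±
  [ _ ] +± ⊥±    = ⊥±
  [ r ] +± [ s ] = [ r + s ]

  totalOrder± : TotalOrder _ _ _
  totalOrder± = record { isTotalOrder = ≤±-isTotalOrder isTotalOrder }

  ----------------------------------------------------------------------
  -- Priors, gain functions and g-entropy

  ∑ : {X : Set x} → Finite X → (X → Carrier) → Carrier
  ∑ F f = sum λ i → f (Finite.element F i)

  record Prior {X : Set x} (F : Finite X) : Set (x ⊔ c ⊔ ℓ) where
    field
      mass   : X → Carrier
      nonNeg : ∀ s → 0# ≤ mass s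
      total  : ∑ F mass ≈ 1#

  record Gain (W : Set w) (X : Set x) : Set (w ⊔ x ⊔ c ⊔ ℓ) where
    field
      gain   : W → X → Carrier
      gain≥0 : ∀ u s → 0# ≤ gain u s
      gain≤1 : ∀ u s → gain u s ≤ 1#

  open Prior
  open Gain

  IsJointGain : {W₁ W₂ : Set w} {X₁ X₂ : Set x} →
                Gain W₁ X₁ → Gain W₂ X₂ → Gain (W₁ × W₂) (X₁ × X₂) →
                Set (w ⊔ x ⊔ ℓ)
  IsJointGain g₁ g₂ g = ∀ w₁ w₂ x₁ x₂ →
    gain g (w₁ , w₂) (x₁ , x₂) ≈ 0# ⇔ gain g₁ w₁ x₁ * gain g₂ w₂ x₂ ≈ 0#

  -- V_g of the distribution on X with mass function p; the number itself is
  -- `value`.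
  record Vulnerability {W : Set w} {X : Set x} (F : Finite X) (g : Gain W X)
                       (p : X → Carrier) : Set (w ⊔ x ⊔ c ⊔ ℓ) where
    field
      maximum : Maximum _≤_ λ u → ∑ F λ s → p s * gain g u s

    open Maximum maximum public using (value)

  entropy : {W : Set w} {X : Set x} {F : Finite X} {g : Gain W X}
            {p : X → Carrier} → Vulnerability F g p → Carrier ±
  entropy V = -± log± [ Vulnerability.value V ]

  module _ {X₁ X₂ : Set x} (F₁ : Finite X₁) (F₂ : Finite X₂)
           (π : Prior (F₁ ×-finite F₂)) where

    marginal₁ : X₁ → Carrier
    marginal₁ x₁ = ∑ F₂ λ x₂ → mass π (x₁ , x₂)

    marginal₂ : X₂ → Carrier
    marginal₂ x₂ = ∑ F₁ λ x₁ → mass π (x₁ , x₂)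

    module _ {W₁ W₂ : Set w} (g₁ : Gain W₁ X₁) (g₂ : Gain W₂ X₂)
             (g : Gain (W₁ × W₂) (X₁ × X₂)) where

      S : W₁ × W₂ → Pred (X₁ × X₂) ℓ
      S u s = ¬ mass π s * gain g u s ≈ 0#

      S? : ∀ u → Decidable (S u)
      S? u s = ¬? (mass π s * gain g u s ≟ 0#)

      ratio : W₁ × W₂ → X₁ × X₂ → Carrier
      ratio (w₁ , w₂) (x₁ , x₂) =
        (marginal₁ x₁ * gain g₁ w₁ x₁ * (marginal₂ x₂ * gain g₂ w₂ x₂))
          ÷ (mass π (x₁ , x₂) * gain g (w₁ , w₂) (x₁ , x₂))

      -- The minimum of the ratios over S u, with min ∅ = +∞.
      minRatio : W₁ × W₂ → Carrier ±
      minRatio u = Extrema.min totalOrder± ⊤±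
        (map (λ s → [ ratio u s ])
             (filter (S? u) (Finite.elements (F₁ ×-finite F₂))))

      M-min : Set (w ⊔ c ⊔ ℓ)
      M-min = Minimum _≤±_ minRatio

{-# OPTIONS --safe #-}
module Submission where

-- Let w = (w₁ , w₂) attain V = V_g(π), and let m = M-min.  By definition of m,
-- m π[x] g(w,x) ≤ π₁[x₁] g₁(w₁,x₁) π₂[x₂] g₂(w₂,x₂) for every x = (x₁ , x₂):
-- this is the bound on the ratio when x ∈ S w, and the left side is 0 otherwise.
-- Summing over x gives m V ≤ V₁ V₂, and the claim is the logarithm of this.
--
-- Of the functional equation of log₂ only a b ≤ c d ⇒ log₂ a + log₂ b ≤ log₂ c + log₂ d
-- is needed.  It follows from superadditivity (the defining sets of lower bounds
-- add up) together with 0 ≤ log₂ d + log₂ (d ⁻¹).  All existence statements about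
-- large natural numbers hold only up to double negation, which is harmless since
-- each of them serves to prove an inequality, and ≤ is decidable.

open import Defs
open import Algebra.Properties.CommutativeSemiring.Exp as Exp using ()
open import Algebra.Properties.Ring as RingProperties using ()
open import Algebra.Properties.Semiring.Mult as Mult using ()
open import Algebra.Properties.Semiring.Sum as Sum using ()
open import Algebra.Solver.Ring.NaturalCoefficients.Default as Solver using ()
open import Data.Fin.Base using (Fin; zero; suc; combine; _↑ˡ_; _↑ʳ_)
open import Data.Fin.Properties using (remQuot-combine)
import Data.List.Extrema as Extrema
open import Data.List.Membership.Propositional using (_∈_)
open import Data.List.Membership.Propositional.Properties using (∈-map⁺; ∈-filter⁺; ∈-tabulate⁺)
import Data.List.Relation.Unary.All as All
import Data.List.Relation.Unary.All.Properties as All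
open import Data.Nat.Base using (ℕ; zero; suc)
import Data.Nat.Base as ℕ
import Data.Nat.Properties as ℕ
open import Data.Product.Base using (_×_; _,_; ∃; ∃-syntax; proj₁; proj₂)
open import Data.Sum.Base using (inj₁; inj₂)
open import Function.Base using (_∘_; case_of_; id)
open import Function.Bundles using (Inverse; Equivalence)
import Level
open import Relation.Binary.Bundles using (Poset)
import Relation.Binary.Construct.Add.Extrema.NonStrict as AddExtrema
open import Relation.Binary.PropositionalEquality.Core as ≡ using (_≡_)
import Relation.Binary.Reasoning.PartialOrder as PosetReasoning
open import Relation.Binary.Structures using (IsDecTotalOrder)
open import Relation.Nullary.Construct.Add.Extrema using (_±; ⊤±; [_])
open import Relation.Nullary.Decidable using (yes; no; decidable-stable)
open import Relation.Nullary.Negation using (¬_; contradiction)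
open import Relation.Unary using (Pred)

-- `minRatio` runs over a list, so bounding it by the ratio at a given pair takes membership of that
-- pair in the list.
∈-elements : ∀ {x} {X : Set x} (F : Finite X) (s : X) → s ∈ Finite.elements F
∈-elements F s = ≡.subst (_∈ Finite.elements F)
  (Inverse.strictlyInverseˡ (Finite.enumeration F) s)
  (∈-tabulate⁺ (Inverse.from (Finite.enumeration F) s))

-- Ordered-field arithmetic

module OrderedField {c ℓ} (ℛ : RealNumbers c ℓ) where

  open RealNumbers ℛ
  open IsDecTotalOrder isDecTotalOrder public
    using (antisym; total; ≤-respˡ-≈; ≤-respʳ-≈; isPartialOrder)
    renaming (refl to ≤-refl; reflexive to ≤-reflexive; trans to ≤-trans)
  open Exp commutativeSemiring public
    using (_^_; ^-congˡ; ^-congʳ; ^-homo-*; ^-assocʳ; ^-distrib-*)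
  open Mult semiring public
    using (×-homo-+; ×-assoc-*; ×1-homo-*; ×-homo-1; ×-congʳ) renaming (_×_ to _·_)
  open RingProperties ring using (-‿distribʳ-*; -‿involutive)

  poset : Poset _ _ _
  poset = record { isPartialOrder = isPartialOrder }

  open PosetReasoning poset

  -- Stated negatively to match the `no` branch of the test `r ≤? 0#` in `log±`; as the order is
  -- total, this is strict positivity.
  Positive : Pred Carrier ℓ
  Positive x = ¬ x ≤ 0#

  ≤-stable : ∀ {x y} → ¬ ¬ x ≤ y → x ≤ y
  ≤-stable {x} {y} = decidable-stable (x ≤? y)

  ≰⇒≥ : ∀ {x y} → ¬ x ≤ y → y ≤ x
  ≰⇒≥ {x} {y} x≰y with total x y
  ... | inj₁ x≤y = contradiction x≤y x≰y
  ... | inj₂ y≤x = y≤x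

  positive⇒≉0 : ∀ {x} → Positive x → ¬ x ≈ 0#
  positive⇒≉0 x>0 x≈0 = x>0 (≤-reflexive x≈0)

  ≥0∧≉0⇒positive : ∀ {x} → 0# ≤ x → ¬ x ≈ 0# → Positive x
  ≥0∧≉0⇒positive x≥0 x≉0 x≤0 = x≉0 (antisym x≤0 x≥0)

  positive-mono : ∀ {x y} → x ≤ y → Positive x → Positive y
  positive-mono x≤y x>0 y≤0 = x>0 (≤-trans x≤y y≤0)

  +-monoʳ-≤ : ∀ z {x y} → x ≤ y → z + x ≤ z + y
  +-monoʳ-≤ z {x} {y} x≤y = begin
    z + x ≈⟨ +-comm z x ⟩
    x + z ≤⟨ +-monoˡ-≤ z x≤y ⟩
    y + z ≈⟨ +-comm y z ⟩
    z + y ∎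

  +-mono-≤ : ∀ {x y u v} → x ≤ y → u ≤ v → x + u ≤ y + v
  +-mono-≤ x≤y u≤v = ≤-trans (+-monoˡ-≤ _ x≤y) (+-monoʳ-≤ _ u≤v)

  x+z-z≈x : ∀ x z → x + z - z ≈ x
  x+z-z≈x x z = trans (+-assoc x z (- z)) (trans (+-congˡ (-‿inverseʳ z)) (+-identityʳ x))

  x-z+z≈x : ∀ x z → x - z + z ≈ x
  x-z+z≈x x z = trans (+-assoc x (- z) z) (trans (+-congˡ (-‿inverseˡ z)) (+-identityʳ x))

  +-cancelʳ-≤ : ∀ z {x y} → x + z ≤ y + z → x ≤ y
  +-cancelʳ-≤ z {x} {y} x+z≤y+z = begin
    x         ≈⟨ x+z-z≈x x z ⟨
    x + z - z ≤⟨ +-monoˡ-≤ (- z) x+z≤y+z ⟩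
    y + z - z ≈⟨ x+z-z≈x y z ⟩
    y         ∎

  x+z≤y⇒x≤y-z : ∀ {x y z} → x + z ≤ y → x ≤ y - z
  x+z≤y⇒x≤y-z {x} {y} {z} x+z≤y =
    +-cancelʳ-≤ z (≤-respʳ-≈ (sym (x-z+z≈x y z)) x+z≤y)

  x≤y-z⇒x+z≤y : ∀ {x y z} → x ≤ y - z → x + z ≤ y
  x≤y-z⇒x+z≤y {x} {y} {z} x≤y-z =
    ≤-respʳ-≈ (x-z+z≈x y z) (+-monoˡ-≤ z x≤y-z)

  +-nonNeg : ∀ {x y} → 0# ≤ x → 0# ≤ y → 0# ≤ x + y
  +-nonNeg x≥0 y≥0 = ≤-respˡ-≈ (+-identityˡ 0#) (+-mono-≤ x≥0 y≥0)

  x≤0⇒0≤-x : ∀ {x} → x ≤ 0# → 0# ≤ - x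
  x≤0⇒0≤-x {x} x≤0 = begin
    0#     ≈⟨ -‿inverseʳ x ⟨
    x - x  ≤⟨ +-monoˡ-≤ (- x) x≤0 ⟩
    0# - x ≈⟨ +-identityˡ (- x) ⟩
    - x    ∎

  -- The order axiom for products speaks of nonnegative factors, here `z` and `y - x`.
  *-monoˡ-≤ : ∀ {z x y} → 0# ≤ z → x ≤ y → z * x ≤ z * y
  *-monoˡ-≤ {z} {x} {y} z≥0 x≤y = begin
    z * x                 ≈⟨ +-identityˡ _ ⟨
    0# + z * x            ≤⟨ +-monoˡ-≤ _ (*-nonNeg z≥0 (x+z≤y⇒x≤y-z (≤-respˡ-≈ (sym (+-identityˡ x)) x≤y))) ⟩
    z * (y - x) + z * x   ≈⟨ distribˡ z (y - x) x ⟨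
    z * (y - x + x)       ≈⟨ *-congˡ (x-z+z≈x y x) ⟩
    z * y                 ∎

  *-monoʳ-≤ : ∀ {z x y} → 0# ≤ z → x ≤ y → x * z ≤ y * z
  *-monoʳ-≤ {z} {x} {y} z≥0 x≤y = begin
    x * z ≈⟨ *-comm x z ⟩
    z * x ≤⟨ *-monoˡ-≤ z≥0 x≤y ⟩
    z * y ≈⟨ *-comm z y ⟩
    y * z ∎

  *-mono-≤ : ∀ {x y u v} → 0# ≤ y → 0# ≤ u → x ≤ y → u ≤ v → x * u ≤ y * v
  *-mono-≤ y≥0 u≥0 x≤y u≤v = ≤-trans (*-monoʳ-≤ u≥0 x≤y) (*-monoˡ-≤ y≥0 u≤v)

  -- If 1 ≤ 0, then -1 is nonnegative, and so is its square, which is 1.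
  0≤1 : 0# ≤ 1#
  0≤1 with total 0# 1#
  ... | inj₁ 0≤1 = 0≤1
  ... | inj₂ 1≤0 = begin
    0#                ≤⟨ *-nonNeg 0≤-1 0≤-1 ⟩
    - 1# * - 1#       ≈⟨ -‿distribʳ-* (- 1#) 1# ⟨
    - (- 1# * 1#)     ≈⟨ -‿cong (*-identityʳ (- 1#)) ⟩
    - - 1#            ≈⟨ -‿involutive 1# ⟩
    1#                ∎
    where 0≤-1 = x≤0⇒0≤-x 1≤0

  1-positive : Positive 1#
  1-positive = ≥0∧≉0⇒positive 0≤1 (0≉1 ∘ sym)

  *-inverseˡ : ∀ {x} → Positive x → x ⁻¹ * x ≈ 1#
  *-inverseˡ {x} x>0 = trans (*-comm (x ⁻¹) x) (*-inverseʳ (positive⇒≉0 x>0))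

  -- If x y ≤ 0, then x y = 0 because both factors are nonnegative, and multiplying by `x ⁻¹` gives
  -- y = 0.
  *-positive : ∀ {x y} → Positive x → Positive y → Positive (x * y)
  *-positive {x} {y} x>0 y>0 xy≤0 = positive⇒≉0 y>0 (begin-equality
    y              ≈⟨ *-identityˡ y ⟨
    1# * y         ≈⟨ *-congʳ (*-inverseˡ x>0) ⟨
    x ⁻¹ * x * y   ≈⟨ *-assoc _ x y ⟩
    x ⁻¹ * (x * y) ≈⟨ *-congˡ (antisym xy≤0 (*-nonNeg (≰⇒≥ x>0) (≰⇒≥ y>0))) ⟩
    x ⁻¹ * 0#      ≈⟨ zeroʳ _ ⟩
    0#             ∎)

  *-≉0ˡ : ∀ {x y} → ¬ x * y ≈ 0# → ¬ x ≈ 0#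
  *-≉0ˡ {y = y} xy≉0 x≈0 = xy≉0 (trans (*-congʳ x≈0) (zeroˡ y))

  *-≉0ʳ : ∀ {x y} → ¬ x * y ≈ 0# → ¬ y ≈ 0#
  *-≉0ʳ {x} xy≉0 y≈0 = xy≉0 (trans (*-congˡ y≈0) (zeroʳ x))

  positive-factors : ∀ {a b} → 0# ≤ a → 0# ≤ b → Positive (a * b) → Positive a × Positive b
  positive-factors a≥0 b≥0 ab>0 =
    ≥0∧≉0⇒positive a≥0 (*-≉0ˡ (positive⇒≉0 ab>0)) ,
    ≥0∧≉0⇒positive b≥0 (*-≉0ʳ (positive⇒≉0 ab>0))

  ⁻¹-positive : ∀ {x} → Positive x → Positive (x ⁻¹)
  ⁻¹-positive {x} x>0 x⁻¹≤0 = 1-positive (begin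
    1#       ≈⟨ *-inverseʳ (positive⇒≉0 x>0) ⟨
    x * x ⁻¹ ≤⟨ *-monoˡ-≤ (≰⇒≥ x>0) x⁻¹≤0 ⟩
    x * 0#   ≈⟨ zeroʳ x ⟩
    0#       ∎)

  *-cancelˡ-≤ : ∀ {z x y} → Positive z → z * x ≤ z * y → x ≤ y
  *-cancelˡ-≤ {z} {x} {y} z>0 zx≤zy = begin
    x              ≈⟨ z⁻¹zx≈x x ⟨
    z ⁻¹ * (z * x) ≤⟨ *-monoˡ-≤ (≰⇒≥ (⁻¹-positive z>0)) zx≤zy ⟩
    z ⁻¹ * (z * y) ≈⟨ z⁻¹zx≈x y ⟩
    y              ∎
    where
    z⁻¹zx≈x : ∀ x → z ⁻¹ * (z * x) ≈ x
    z⁻¹zx≈x x = trans (sym (*-assoc _ z x)) (trans (*-congʳ (*-inverseˡ z>0)) (*-identityˡ x))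

  x≤y÷z⇒xz≤y : ∀ {x y z} → Positive z → x ≤ y * z ⁻¹ → x * z ≤ y
  x≤y÷z⇒xz≤y {x} {y} {z} z>0 x≤y/z = begin
    x * z          ≤⟨ *-monoʳ-≤ (≰⇒≥ z>0) x≤y/z ⟩
    y * z ⁻¹ * z   ≈⟨ *-assoc y _ z ⟩
    y * (z ⁻¹ * z) ≈⟨ *-congˡ (*-inverseˡ z>0) ⟩
    y * 1#         ≈⟨ *-identityʳ y ⟩
    y              ∎

  ^-positive : ∀ {x} n → Positive x → Positive (x ^ n)
  ^-positive zero    x>0 = 1-positive
  ^-positive (suc n) x>0 = *-positive x>0 (^-positive n x>0)

  ^-mono-≤ : ∀ {x y} n → Positive x → x ≤ y → x ^ n ≤ y ^ n
  ^-mono-≤ zero    x>0 x≤y = ≤-refl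
  ^-mono-≤ (suc n) x>0 x≤y =
    *-mono-≤ (≤-trans (≰⇒≥ x>0) x≤y) (≰⇒≥ (^-positive n x>0)) x≤y (^-mono-≤ n x>0 x≤y)

  -- Natural multiples and the Archimedean property

  n·x≈n·1*x : ∀ n x → n · x ≈ n · 1# * x
  n·x≈n·1*x n x = sym (trans (×-assoc-* n 1# x) (×-congʳ n (*-identityˡ x)))

  n·1≥0 : ∀ n → 0# ≤ n · 1#
  n·1≥0 zero    = ≤-refl
  n·1≥0 (suc n) = +-nonNeg 0≤1 (n·1≥0 n)

  suc-n·1-positive : ∀ n → Positive (suc n · 1#)
  suc-n·1-positive n = positive-mono
    (≤-respˡ-≈ (+-identityʳ 1#) (+-monoʳ-≤ 1# (n·1≥0 n))) 1-positive

  ·-monoʳ-≤ : ∀ n {x y} → x ≤ y → n · x ≤ n · y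
  ·-monoʳ-≤ n {x} {y} x≤y = begin
    n · x      ≈⟨ n·x≈n·1*x n x ⟩
    n · 1# * x ≤⟨ *-monoˡ-≤ (n·1≥0 n) x≤y ⟩
    n · 1# * y ≈⟨ n·x≈n·1*x n y ⟨
    n · y      ∎

  ·-cancelˡ-≤ : ∀ k {x y} → suc k · x ≤ suc k · y → x ≤ y
  ·-cancelˡ-≤ k {x} {y} kx≤ky = *-cancelˡ-≤ (suc-n·1-positive k) (begin
    suc k · 1# * x ≈⟨ n·x≈n·1*x (suc k) x ⟨
    suc k · x      ≤⟨ kx≤ky ⟩
    suc k · y      ≈⟨ n·x≈n·1*x (suc k) y ⟩
    suc k · 1# * y ∎)

  ·1-mono-≤ : ∀ {m n} → m ℕ.≤ n → m · 1# ≤ n · 1#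
  ·1-mono-≤ {n = n} ℕ.z≤n     = n·1≥0 n
  ·1-mono-≤         (ℕ.s≤s m≤n) = +-monoʳ-≤ 1# (·1-mono-≤ m≤n)

  -- If no natural number exceeded x, their supremum s would satisfy 1 + s ≤ s.
  archimedean : ∀ x → ¬ ¬ (∃[ n ] x ≤ n · 1#)
  archimedean x no-bound = 1-positive (begin
    1#      ≤⟨ x+z≤y⇒x≤y-z (≤-respʳ-≈ (sym (+-identityˡ s)) 1+s≤s) ⟩
    0# + s - s ≈⟨ x+z-z≈x 0# s ⟩
    0#      ∎)
    where
    IsNatural : Pred Carrier ℓ
    IsNatural y = ∃[ n ] y ≈ n · 1#

    inhabited : ∃ IsNatural
    inhabited = 0# , 0 , refl

    bounded : ∃ (IsUpperBound IsNatural)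
    bounded = x , λ { y (n , y≈n) → ≤-respˡ-≈ (sym y≈n) (≰⇒≥ λ x≤n → no-bound (n , x≤n)) }

    s : Carrier
    s = sup IsNatural

    1+s≤s : 1# + s ≤ s
    1+s≤s = begin
      1# + s     ≈⟨ +-comm 1# s ⟩
      s + 1#     ≤⟨ x≤y-z⇒x+z≤y (sup-least IsNatural inhabited bounded (s - 1#) λ
                     { y (n , y≈n) → x+z≤y⇒x≤y-z
                         (sup-upper IsNatural inhabited bounded (y + 1#)
                           (suc n , trans (+-comm y 1#) (+-congˡ y≈n))) }) ⟩
      s          ∎

  archimedean-positive : ∀ {x} → Positive x → ¬ ¬ (∃[ n ] 1# ≤ n · x)
  archimedean-positive {x} x>0 none = archimedean (x ⁻¹) λ { (n , x⁻¹≤n) → none (n , (begin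
    1#         ≈⟨ *-inverseˡ x>0 ⟨
    x ⁻¹ * x   ≤⟨ *-monoʳ-≤ (≰⇒≥ x>0) x⁻¹≤n ⟩
    n · 1# * x ≈⟨ n·x≈n·1*x n x ⟨
    n · x      ∎)) }

  -- Powers of 2

  2# : Carrier
  2# = 1# + 1#

  1≤2 : 1# ≤ 2#
  1≤2 = ≤-respˡ-≈ (+-identityʳ 1#) (+-monoʳ-≤ 1# 0≤1)

  2^-positive : ∀ n → Positive (2# ^ n)
  2^-positive n = ^-positive n (positive-mono 1≤2 1-positive)

  2^suc : ∀ n → 2# ^ suc n ≈ 2# ^ n + 2# ^ n
  2^suc n = trans (distribʳ _ 1# 1#) (+-cong (*-identityˡ _) (*-identityˡ _))

  1≤2^n : ∀ n → 1# ≤ 2# ^ n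
  1≤2^n zero    = ≤-refl
  1≤2^n (suc n) = begin
    1#          ≤⟨ 1≤2^n n ⟩
    2# ^ n      ≈⟨ *-identityˡ _ ⟨
    1# * 2# ^ n ≤⟨ *-monoʳ-≤ (≰⇒≥ (2^-positive n)) 1≤2 ⟩
    2# * 2# ^ n ∎

  -- Raising n by 1 adds 1 on the left and 2^n ≥ 1 on the right. Through the Archimedean property
  -- this makes the powers of 2 unbounded.
  n·1≤2^n : ∀ n → n · 1# ≤ 2# ^ n
  n·1≤2^n zero    = 0≤1
  n·1≤2^n (suc n) = ≤-respʳ-≈ (sym (2^suc n)) (+-mono-≤ (1≤2^n n) (n·1≤2^n n))

  2^-unbounded : ∀ x → ¬ ¬ (∃[ n ] x ≤ 2# ^ n)
  2^-unbounded x none = archimedean x λ { (n , x≤n) → none (n , ≤-trans x≤n (n·1≤2^n n)) }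

  2^-mono-≤ : ∀ {m n} → m ℕ.≤ n → 2# ^ m ≤ 2# ^ n
  2^-mono-≤ {m} m≤n with k , ≡.refl ← ℕ.m≤n⇒∃[o]m+o≡n m≤n = begin
    2# ^ m          ≈⟨ *-identityʳ _ ⟨
    2# ^ m * 1#     ≤⟨ *-monoˡ-≤ (≰⇒≥ (2^-positive m)) (1≤2^n k) ⟩
    2# ^ m * 2# ^ k ≈⟨ ^-homo-* 2# m k ⟨
    2# ^ (m ℕ.+ k)  ∎

  2^suc≰2^ : ∀ n → ¬ 2# ^ suc n ≤ 2# ^ n
  2^suc≰2^ n 2ⁿ⁺¹≤2ⁿ = 2^-positive n (+-cancelʳ-≤ (2# ^ n) (begin
    2# ^ n + 2# ^ n ≈⟨ 2^suc n ⟨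
    2# ^ suc n      ≤⟨ 2ⁿ⁺¹≤2ⁿ ⟩
    2# ^ n          ≈⟨ +-identityˡ _ ⟨
    0# + 2# ^ n     ∎))

  -- Brings an inequality of reals back to natural exponents. If n < m, then 2^(n+1) ≤ 2^m ≤ 2^n,
  -- which would force 2^n ≤ 0.
  2^-cancel-≤ : ∀ {m n} → 2# ^ m ≤ 2# ^ n → m ℕ.≤ n
  2^-cancel-≤ {m} {n} 2ᵐ≤2ⁿ with m ℕ.≤? n
  ... | yes m≤n = m≤n
  ... | no  m≰n = contradiction (≤-trans (2^-mono-≤ (ℕ.≰⇒> m≰n)) 2ᵐ≤2ⁿ) (2^suc≰2^ n)

  -- A downward search from the bound 2^N by the decidable order; 1 ≤ t guarantees success at
  -- exponent 0 at the latest.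
  2^-bracket : ∀ {t} N → 1# ≤ t → t ≤ 2# ^ N → ∃[ m ] (2# ^ m ≤ t) × (t ≤ 2# ^ suc m)
  2^-bracket     zero    1≤t t≤1 = 0 , 1≤t , ≤-trans t≤1 (1≤2^n 1)
  2^-bracket {t} (suc N) 1≤t t≤2ᴺ⁺¹ with t ≤? 2# ^ N
  ... | yes t≤2ᴺ = 2^-bracket N 1≤t t≤2ᴺ
  ... | no  t≰2ᴺ = N , ≰⇒≥ t≰2ᴺ , t≤2ᴺ⁺¹

-- The base-2 logarithm

module Logarithm {c ℓ} (ℛ : RealNumbers c ℓ) where

  open RealNumbers ℛ
  open OrderedField ℛ
  open Entropy ℛ using (log₂)
  open PosetReasoning poset
  open Solver commutativeSemiring using (solve; _:+_; _:*_; _:=_)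

  -- The predicate inside the definition of `log₂`, so that `log₂ r` is its supremum definitionally.
  -- A witness presents y as the rational (m - n) / (1 + k).
  IsLogLowerBound : Carrier → Pred Carrier ℓ
  IsLogLowerBound r y = ∃[ m ] ∃[ n ] ∃[ k ]
    (suc k · y + n · 1# ≈ m · 1#) × (2# ^ m ≤ 2# ^ n * r ^ suc k)

  2^*-^ : ∀ r n k l → (2# ^ n * r ^ k) ^ l ≈ 2# ^ (n ℕ.* l) * r ^ (k ℕ.* l)
  2^*-^ r n k l = begin-equality
    (2# ^ n * r ^ k) ^ l               ≈⟨ ^-distrib-* (2# ^ n) (r ^ k) l ⟩
    (2# ^ n) ^ l * (r ^ k) ^ l         ≈⟨ *-cong (^-assocʳ 2# n l) (^-assocʳ r k l) ⟩
    2# ^ (n ℕ.* l) * r ^ (k ℕ.* l)     ∎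

  -- From 2^m ≤ 2^n r^(1+k) ≤ 2^(n + N(1+k)) follows m ≤ n + N(1+k); subtract n and divide by 1 + k.
  lowerBound-≤ : ∀ {r y} N → Positive r → r ≤ 2# ^ N → IsLogLowerBound r y → y ≤ N · 1#
  lowerBound-≤ {r} {y} N r>0 r≤2ᴺ (m , n , k , ky+n≈m , 2ᵐ≤) =
    ·-cancelˡ-≤ k (+-cancelʳ-≤ (n · 1#) (begin
      suc k · y + n · 1#              ≈⟨ ky+n≈m ⟩
      m · 1#                          ≤⟨ ·1-mono-≤ m≤n+Nk ⟩
      (n ℕ.+ N ℕ.* suc k) · 1#        ≈⟨ ×-homo-+ 1# n (N ℕ.* suc k) ⟩
      n · 1# + (N ℕ.* suc k) · 1#     ≈⟨ +-comm _ _ ⟩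
      (N ℕ.* suc k) · 1# + n · 1#     ≈⟨ +-congʳ Nk≈k·N ⟩
      suc k · (N · 1#) + n · 1#       ∎))
    where
    m≤n+Nk : m ℕ.≤ n ℕ.+ N ℕ.* suc k
    m≤n+Nk = 2^-cancel-≤ (begin
      2# ^ m                        ≤⟨ 2ᵐ≤ ⟩
      2# ^ n * r ^ suc k            ≤⟨ *-monoˡ-≤ (≰⇒≥ (2^-positive n)) (^-mono-≤ (suc k) r>0 r≤2ᴺ) ⟩
      2# ^ n * (2# ^ N) ^ suc k     ≈⟨ *-congˡ (^-assocʳ 2# N (suc k)) ⟩
      2# ^ n * 2# ^ (N ℕ.* suc k)   ≈⟨ ^-homo-* 2# n (N ℕ.* suc k) ⟨
      2# ^ (n ℕ.+ N ℕ.* suc k)      ∎)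

    Nk≈k·N : (N ℕ.* suc k) · 1# ≈ suc k · (N · 1#)
    Nk≈k·N = begin-equality
      (N ℕ.* suc k) · 1#    ≈⟨ ×1-homo-* N (suc k) ⟩
      N · 1# * suc k · 1#   ≈⟨ *-comm _ _ ⟩
      suc k · 1# * N · 1#   ≈⟨ n·x≈n·1*x (suc k) (N · 1#) ⟨
      suc k · (N · 1#)      ∎

  lowerBounds-bounded : ∀ {r} → Positive r → ¬ ¬ ∃ (IsUpperBound (IsLogLowerBound r))
  lowerBounds-bounded {r} r>0 unbounded = 2^-unbounded r λ { (N , r≤2ᴺ) →
    unbounded (N · 1# , λ y → lowerBound-≤ N r>0 r≤2ᴺ) }

  lowerBounds-inhabited : ∀ {r} → Positive r → ¬ ¬ ∃ (IsLogLowerBound r)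
  lowerBounds-inhabited {r} r>0 empty = 2^-unbounded (r ⁻¹) λ { (n , r⁻¹≤2ⁿ) →
    -- The lower bound is the integer -n, that is (0 - n) / 1, since 1 ≤ 2^n r once 2^n exceeds
    -- `r ⁻¹`.
    empty (- (n · 1#) , 0 , n , 0 ,
      trans (+-congʳ (×-homo-1 _)) (-‿inverseˡ _) ,
      (begin
        1#               ≈⟨ *-inverseˡ r>0 ⟨
        r ⁻¹ * r         ≤⟨ *-monoʳ-≤ (≰⇒≥ r>0) r⁻¹≤2ⁿ ⟩
        2# ^ n * r       ≈⟨ *-congˡ (*-identityʳ r) ⟨
        2# ^ n * r ^ 1   ∎)) }

  -- `sup-upper` asks for some upper bound, and one is at hand only under a double negation;
  -- `≤-stable` removes it from the goal. In `log₂-least` the same happens with inhabitedness.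
  log₂-upper : ∀ {r y} → Positive r → IsLogLowerBound r y → y ≤ log₂ r
  log₂-upper {r} {y} r>0 y∈L = ≤-stable λ y≰log → lowerBounds-bounded r>0 λ bounded →
    y≰log (sup-upper (IsLogLowerBound r) (y , y∈L) bounded y y∈L)

  log₂-least : ∀ {r u} → Positive r → IsUpperBound (IsLogLowerBound r) u → log₂ r ≤ u
  log₂-least {r} {u} r>0 ub = ≤-stable λ log≰u → lowerBounds-inhabited r>0 λ inhabited →
    log≰u (sup-least (IsLogLowerBound r) inhabited (u , ub) u ub)

  -- A lower bound for r is one for s with the same m, n, k, because powers are monotone.
  log₂-mono-≤ : ∀ {r s} → Positive r → r ≤ s → log₂ r ≤ log₂ s
  log₂-mono-≤ r>0 r≤s = log₂-least r>0 λ { y (m , n , k , ky+n≈m , 2ᵐ≤) →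
    log₂-upper (positive-mono r≤s r>0)
      (m , n , k , ky+n≈m ,
       ≤-trans 2ᵐ≤ (*-monoˡ-≤ (≰⇒≥ (2^-positive n)) (^-mono-≤ (suc k) r>0 r≤s))) }

  -- Fractions are added over the common denominator `K * K′`. The two power inequalities are raised
  -- to `K′` and `K` and multiplied.
  lowerBound-+ : ∀ {a b y z} → Positive a → Positive b → IsLogLowerBound a y →
                 IsLogLowerBound b z → IsLogLowerBound (a * b) (y + z)
  lowerBound-+ {a} {b} {y} {z} a>0 b>0 (m , n , k , ky+n≈m , 2ᵐ≤) (m′ , n′ , k′ , k′z+n′≈m′ , 2ᵐ′≤) =
    -- The third witness is one less than the denominator: its successor reduces to `K * K′`.
    m ℕ.* K′ ℕ.+ m′ ℕ.* K , n ℕ.* K′ ℕ.+ n′ ℕ.* K , k′ ℕ.+ k ℕ.* K′ , linear , power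
    where
    K  = suc k
    K′ = suc k′

    split : ∀ p q → (p ℕ.* K′ ℕ.+ q ℕ.* K) · 1# ≈ p · 1# * K′ · 1# + q · 1# * K · 1#
    split p q = trans (×-homo-+ 1# (p ℕ.* K′) (q ℕ.* K)) (+-cong (×1-homo-* p K′) (×1-homo-* q K))

    linear : (K ℕ.* K′) · (y + z) + (n ℕ.* K′ ℕ.+ n′ ℕ.* K) · 1# ≈ (m ℕ.* K′ ℕ.+ m′ ℕ.* K) · 1#
    linear = begin-equality
      (K ℕ.* K′) · (y + z) + (n ℕ.* K′ ℕ.+ n′ ℕ.* K) · 1#
        ≈⟨ +-cong (trans (n·x≈n·1*x (K ℕ.* K′) (y + z)) (*-congʳ (×1-homo-* K K′))) (split n n′) ⟩
      K · 1# * K′ · 1# * (y + z) + (n · 1# * K′ · 1# + n′ · 1# * K · 1#)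
        ≈⟨ solve 6 (λ κ κ′ y z n n′ →
             κ :* κ′ :* (y :+ z) :+ (n :* κ′ :+ n′ :* κ) :=
             (κ :* y :+ n) :* κ′ :+ (κ′ :* z :+ n′) :* κ) refl (K · 1#) (K′ · 1#) y z (n · 1#) (n′ · 1#) ⟩
      (K · 1# * y + n · 1#) * K′ · 1# + (K′ · 1# * z + n′ · 1#) * K · 1#
        ≈⟨ +-cong (*-congʳ (trans (+-congʳ (sym (n·x≈n·1*x K y))) ky+n≈m))
                  (*-congʳ (trans (+-congʳ (sym (n·x≈n·1*x K′ z))) k′z+n′≈m′)) ⟩
      m · 1# * K′ · 1# + m′ · 1# * K · 1#
        ≈⟨ split m m′ ⟨
      (m ℕ.* K′ ℕ.+ m′ ℕ.* K) · 1# ∎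

    2^-split : ∀ p q → 2# ^ (p ℕ.* K′ ℕ.+ q ℕ.* K) ≈ 2# ^ (p ℕ.* K′) * 2# ^ (q ℕ.* K)
    2^-split p q = ^-homo-* 2# (p ℕ.* K′) (q ℕ.* K)

    power : 2# ^ (m ℕ.* K′ ℕ.+ m′ ℕ.* K) ≤ 2# ^ (n ℕ.* K′ ℕ.+ n′ ℕ.* K) * (a * b) ^ (K ℕ.* K′)
    power = begin
      2# ^ (m ℕ.* K′ ℕ.+ m′ ℕ.* K)
        ≈⟨ 2^-split m m′ ⟩
      2# ^ (m ℕ.* K′) * 2# ^ (m′ ℕ.* K)
        ≈⟨ *-cong (^-assocʳ 2# m K′) (^-assocʳ 2# m′ K) ⟨
      (2# ^ m) ^ K′ * (2# ^ m′) ^ K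
        ≤⟨ *-mono-≤
             (≰⇒≥ (^-positive K′ (*-positive (2^-positive n) (^-positive K a>0))))
             (≰⇒≥ (^-positive K (2^-positive m′)))
             (^-mono-≤ K′ (2^-positive m) 2ᵐ≤) (^-mono-≤ K (2^-positive m′) 2ᵐ′≤) ⟩
      (2# ^ n * a ^ K) ^ K′ * (2# ^ n′ * b ^ K′) ^ K
        ≈⟨ *-cong (2^*-^ a n K K′) (2^*-^ b n′ K′ K) ⟩
      2# ^ (n ℕ.* K′) * a ^ (K ℕ.* K′) * (2# ^ (n′ ℕ.* K) * b ^ (K′ ℕ.* K))
        ≈⟨ *-congˡ (*-congˡ (^-congʳ b (ℕ.*-comm K′ K))) ⟩
      2# ^ (n ℕ.* K′) * a ^ (K ℕ.* K′) * (2# ^ (n′ ℕ.* K) * b ^ (K ℕ.* K′))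
        ≈⟨ solve 4 (λ s t u v → s :* t :* (u :* v) := s :* u :* (t :* v)) refl
             (2# ^ (n ℕ.* K′)) (a ^ (K ℕ.* K′)) (2# ^ (n′ ℕ.* K)) (b ^ (K ℕ.* K′)) ⟩
      2# ^ (n ℕ.* K′) * 2# ^ (n′ ℕ.* K) * (a ^ (K ℕ.* K′) * b ^ (K ℕ.* K′))
        ≈⟨ *-cong (2^-split n n′) (^-distrib-* a b (K ℕ.* K′)) ⟨
      2# ^ (n ℕ.* K′ ℕ.+ n′ ℕ.* K) * (a * b) ^ (K ℕ.* K′) ∎

  log₂-superadditive : ∀ {a b} → Positive a → Positive b → log₂ a + log₂ b ≤ log₂ (a * b)
  -- The suprema are handled one at a time: everything but `log₂ a` moves to the right, then, with y
  -- fixed, everything but `log₂ b`.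
  log₂-superadditive {a} {b} a>0 b>0 = x≤y-z⇒x+z≤y (log₂-least a>0 λ y y∈L →
    x+z≤y⇒x≤y-z (≤-respˡ-≈ (+-comm _ y) (x≤y-z⇒x+z≤y (log₂-least b>0 λ z z∈L →
      x+z≤y⇒x≤y-z (≤-respˡ-≈ (+-comm y z)
        (log₂-upper (*-positive a>0 b>0) (lowerBound-+ a>0 b>0 y∈L z∈L)))))))

  -- Bracketing d ^ (1 + k) between consecutive powers of 2 approximates
  -- log₂ d and log₂ e = - log₂ d from below with total error 1 / (1 + k).
  lowerBounds-inverse : ∀ {d e} k → Positive d → Positive e → d * e ≈ 1# →
    ¬ ¬ (∃[ y ] ∃[ z ] IsLogLowerBound d y × IsLogLowerBound e z × (suc k · (y + z) + 1# ≈ 0#))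
  lowerBounds-inverse {d} {e} k d>0 e>0 de≈1 none =
    -- The factor 2^n lifts t = 2^n d^K to at least e^K d^K = 1, so that t can be bracketed with a
    -- natural exponent m.
    2^-unbounded (e ^ K) λ { (n , eᴷ≤2ⁿ) →
    2^-unbounded (2# ^ n * d ^ K) λ { (N , t≤2ᴺ) →
    let 1≤t = begin
          1#                ≈⟨ eᴷdᴷ≈1 ⟨
          e ^ K * d ^ K     ≤⟨ *-monoʳ-≤ (≰⇒≥ (^-positive K d>0)) eᴷ≤2ⁿ ⟩
          2# ^ n * d ^ K    ∎
        m , 2ᵐ≤t , t≤2ᵐ⁺¹ = 2^-bracket N 1≤t t≤2ᴺ
        -- Multiplying t ≤ 2^(m+1) by e^K cancels d^K, which turns the upper end of the bracket into
        -- a lower bound for `log₂ e`.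
        2ⁿ≤ = begin
          2# ^ n                     ≈⟨ *-identityʳ _ ⟨
          2# ^ n * 1#                ≈⟨ *-congˡ (trans (*-comm (d ^ K) (e ^ K)) eᴷdᴷ≈1) ⟨
          2# ^ n * (d ^ K * e ^ K)   ≈⟨ *-assoc (2# ^ n) (d ^ K) (e ^ K) ⟨
          2# ^ n * d ^ K * e ^ K     ≤⟨ *-monoʳ-≤ (≰⇒≥ (^-positive K e>0)) t≤2ᵐ⁺¹ ⟩
          2# ^ suc m * e ^ K         ∎
    -- The fractions (m - n) / K and (n - (m + 1)) / K add up to -1 / K.
    in none (quotient m n , quotient n (suc m) ,
         (m , n , k , quotient-correct m n , 2ᵐ≤t) ,
         (n , suc m , k , quotient-correct n (suc m) , 2ⁿ≤) ,
         total-error m n) } }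
    where
    K = suc k

    eᴷdᴷ≈1 : e ^ K * d ^ K ≈ 1#
    eᴷdᴷ≈1 = begin-equality
      e ^ K * d ^ K ≈⟨ ^-distrib-* e d K ⟨
      (e * d) ^ K   ≈⟨ ^-congˡ K (trans (*-comm e d) de≈1) ⟩
      1# ^ K        ≈⟨ 1^n≈1 K ⟩
      1#            ∎
      where
      1^n≈1 : ∀ n → 1# ^ n ≈ 1#
      1^n≈1 zero    = refl
      1^n≈1 (suc n) = trans (*-identityˡ _) (1^n≈1 n)

    quotient : ℕ → ℕ → Carrier
    quotient p q = (K · 1#) ⁻¹ * (p · 1# - q · 1#)

    K·quotient : ∀ p q → K · quotient p q ≈ p · 1# - q · 1#
    K·quotient p q = begin-equality
      K · quotient p q                              ≈⟨ n·x≈n·1*x K (quotient p q) ⟩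
      K · 1# * ((K · 1#) ⁻¹ * (p · 1# - q · 1#))    ≈⟨ *-assoc _ _ _ ⟨
      K · 1# * (K · 1#) ⁻¹ * (p · 1# - q · 1#)      ≈⟨ *-congʳ (*-inverseʳ (positive⇒≉0 (suc-n·1-positive k))) ⟩
      1# * (p · 1# - q · 1#)                        ≈⟨ *-identityˡ _ ⟩
      p · 1# - q · 1#                               ∎

    quotient-correct : ∀ p q → K · quotient p q + q · 1# ≈ p · 1#
    quotient-correct p q = trans (+-congʳ (K·quotient p q)) (x-z+z≈x (p · 1#) (q · 1#))

    total-error : ∀ m n → K · (quotient m n + quotient n (suc m)) + 1# ≈ 0#
    total-error m n = begin-equality
      K · (y + z) + 1#                                ≈⟨ +-congʳ (trans (n·x≈n·1*x K (y + z)) (distribˡ (K · 1#) y z)) ⟩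
      K · 1# * y + K · 1# * z + 1#                    ≈⟨ +-congʳ (+-cong (n·x≈n·1*x K y) (n·x≈n·1*x K z)) ⟨
      K · y + K · z + 1#                              ≈⟨ +-congʳ (+-cong (K·quotient m n) (K·quotient n (suc m))) ⟩
      -- The solver works in the semiring, so negatives enter as separate variables and cancel in
      -- the next step.
      M - N + (N - suc m · 1#) + 1#                   ≈⟨ solve 5 (λ p q q′ r i →
                                                           p :+ q′ :+ (q :+ r) :+ i := q′ :+ q :+ (i :+ p :+ r))
                                                         refl M N (- N) (- (suc m · 1#)) 1# ⟩
      - N + N + (suc m · 1# - suc m · 1#)             ≈⟨ +-cong (-‿inverseˡ N) (-‿inverseʳ (suc m · 1#)) ⟩
      0# + 0#                                         ≈⟨ +-identityˡ 0# ⟩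
      0#                                              ∎
      where
      y = quotient m n
      z = quotient n (suc m)
      M = m · 1#
      N = n · 1#

  -- Suppose u = `log₂ d + log₂ e` is negative and take k with k(-u) ≥ 1. The approximations with
  -- denominator 1 + k give (1 + k)u ≥ -1; adding the two leaves the one surplus copy of u, so u ≥
  -- 0.
  log₂-inverse-≥0 : ∀ {d e} → Positive d → Positive e → d * e ≈ 1# → 0# ≤ log₂ d + log₂ e
  log₂-inverse-≥0 {d} {e} d>0 e>0 de≈1 = ≤-stable λ 0≰u →
    archimedean-positive (-u>0 0≰u) λ { (k , 1≤k·-u) →
    lowerBounds-inverse k d>0 e>0 de≈1 λ { (y , z , y∈L , z∈L , error) →
    0≰u (+-cancelʳ-≤ 1# (begin
      0# + 1#                     ≤⟨ +-monoʳ-≤ 0# 1≤k·-u ⟩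
      0# + k · (- u)              ≈⟨ +-congʳ error ⟨
      suc k · (y + z) + 1# + k · (- u)
        ≤⟨ +-monoˡ-≤ _ (+-monoˡ-≤ 1# (·-monoʳ-≤ (suc k) (+-mono-≤ (log₂-upper d>0 y∈L) (log₂-upper e>0 z∈L)))) ⟩
      suc k · u + 1# + k · (- u)  ≈⟨ rearrange k ⟩
      u + 1#                      ∎)) } }
    where
    u = log₂ d + log₂ e

    -u>0 : ¬ 0# ≤ u → Positive (- u)
    -u>0 0≰u -u≤0 = 0≰u (begin
      0#      ≈⟨ -‿inverseˡ u ⟨
      - u + u ≤⟨ +-monoˡ-≤ u -u≤0 ⟩
      0# + u  ≈⟨ +-identityˡ u ⟩
      u       ∎)

    rearrange : ∀ k → suc k · u + 1# + k · (- u) ≈ u + 1#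
    rearrange k = begin-equality
      u + k · u + 1# + k · (- u)     ≈⟨ +-cong (+-congʳ (+-congˡ (n·x≈n·1*x k u))) (n·x≈n·1*x k (- u)) ⟩
      u + κ * u + 1# + κ * (- u)     ≈⟨ solve 4 (λ u κ v i →
                                          u :+ κ :* u :+ i :+ κ :* v := (u :+ i) :+ κ :* (u :+ v))
                                        refl u κ (- u) 1# ⟩
      (u + 1#) + κ * (u - u)         ≈⟨ +-congˡ (trans (*-congˡ (-‿inverseʳ u)) (zeroʳ κ)) ⟩
      (u + 1#) + 0#                  ≈⟨ +-identityʳ _ ⟩
      u + 1#                         ∎
      where κ = k · 1#

  -- Adding `log₂ (d ⁻¹) + log₂ d`, which is nonnegative, lets superadditivity merge `d ⁻¹` with a
  -- b; monotonicity then applies, as a b / d ≤ c.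
  log₂-product-≤ : ∀ {a b c d} → Positive a → Positive b → Positive c → Positive d →
                   a * b ≤ c * d → log₂ a + log₂ b ≤ log₂ c + log₂ d
  log₂-product-≤ {a} {b} {c} {d} a>0 b>0 c>0 d>0 ab≤cd = begin
    log₂ a + log₂ b                          ≈⟨ +-identityʳ _ ⟨
    log₂ a + log₂ b + 0#                     ≤⟨ +-mono-≤ (log₂-superadditive a>0 b>0)
                                                  (log₂-inverse-≥0 d⁻¹>0 d>0 (*-inverseˡ d>0)) ⟩
    log₂ (a * b) + (log₂ (d ⁻¹) + log₂ d)    ≈⟨ +-assoc _ _ _ ⟨
    log₂ (a * b) + log₂ (d ⁻¹) + log₂ d      ≤⟨ +-monoˡ-≤ _ (log₂-superadditive ab>0 d⁻¹>0) ⟩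
    log₂ (a * b * d ⁻¹) + log₂ d             ≤⟨ +-monoˡ-≤ _ (log₂-mono-≤ (*-positive ab>0 d⁻¹>0) abd⁻¹≤c) ⟩
    log₂ c + log₂ d                          ∎
    where
    d⁻¹>0 = ⁻¹-positive d>0
    ab>0  = *-positive a>0 b>0

    abd⁻¹≤c : a * b * d ⁻¹ ≤ c
    abd⁻¹≤c = begin
      a * b * d ⁻¹   ≤⟨ *-monoʳ-≤ (≰⇒≥ d⁻¹>0) ab≤cd ⟩
      c * d * d ⁻¹   ≈⟨ *-assoc c d _ ⟩
      c * (d * d ⁻¹) ≈⟨ *-congˡ (*-inverseʳ (positive⇒≉0 d>0)) ⟩
      c * 1#         ≈⟨ *-identityʳ c ⟩
      c              ∎

module VulnerabilityBound {c ℓ} (ℛ : RealNumbers c ℓ) where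

  open RealNumbers ℛ hiding (zero)
  open OrderedField ℛ
  open Entropy ℛ
  open AddExtrema _≤_ using (≤±-trans; [≤]-injective; _≤⊤±) renaming ([_] to ≤±[_])
  open Logarithm ℛ using (log₂-product-≤)
  open Prior
  open Gain
  open PosetReasoning poset
  open Solver commutativeSemiring using (solve; _:+_; _:=_)
  open Sum semiring using (sum; sum-cong-≋; sum-cong-≗; *-distribˡ-sum; *-distribʳ-sum; sum-replicate-zero)

  -- Finite sums and sums over products

  sum-mono-≤ : ∀ {n} {f g : Fin n → Carrier} → (∀ i → f i ≤ g i) → sum f ≤ sum g
  sum-mono-≤ {zero}  f≤g = ≤-refl
  sum-mono-≤ {suc n} f≤g = +-mono-≤ (f≤g zero) (sum-mono-≤ (f≤g ∘ suc))

  sum-nonNeg : ∀ {n} {f : Fin n → Carrier} → (∀ i → 0# ≤ f i) → 0# ≤ sum f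
  sum-nonNeg {n} f≥0 = ≤-respˡ-≈ (sum-replicate-zero n) (sum-mono-≤ f≥0)

  term≤sum : ∀ {n} {f : Fin n → Carrier} → (∀ i → 0# ≤ f i) → ∀ i → f i ≤ sum f
  term≤sum {f = f} f≥0 zero    = ≤-respˡ-≈ (+-identityʳ (f zero)) (+-monoʳ-≤ (f zero) (sum-nonNeg (f≥0 ∘ suc)))
  term≤sum {f = f} f≥0 (suc i) = ≤-respˡ-≈ (+-identityˡ (f (suc i))) (+-mono-≤ (f≥0 zero) (term≤sum (f≥0 ∘ suc) i))

  sum-↑ : ∀ m {n} (f : Fin (m ℕ.+ n) → Carrier) →
          sum f ≈ sum (λ i → f (i ↑ˡ n)) + sum (λ j → f (m ↑ʳ j))
  sum-↑ zero    f = sym (+-identityˡ _)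
  sum-↑ (suc m) f = trans (+-congˡ (sum-↑ m (f ∘ suc))) (sym (+-assoc _ _ _))

  -- `combine` numbers pairs row by row: the first n indices form row `zero`, and shifting by n
  -- reaches the remaining rows.
  sum-combine : ∀ m {n} (f : Fin (m ℕ.* n) → Carrier) →
                sum f ≈ sum {m} λ i → sum {n} λ j → f (combine i j)
  sum-combine zero        f = refl
  sum-combine (suc m) {n} f = trans (sum-↑ n f) (+-congˡ (sum-combine m (λ i → f (n ↑ʳ i))))

  module _ {x} {X : Set x} (F : Finite X) where

    open Finite F using (size; element; enumeration)

    ∑-cong : {f g : X → Carrier} → (∀ s → f s ≈ g s) → ∑ F f ≈ ∑ F g
    ∑-cong f≈g = sum-cong-≋ λ i → f≈g (element i)

    ∑-zero : {f : X → Carrier} → (∀ s → f s ≈ 0#) → ∑ F f ≈ 0#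
    ∑-zero f≈0 = trans (∑-cong f≈0) (sum-replicate-zero size)

    ∑-mono-≤ : {f g : X → Carrier} → (∀ s → f s ≤ g s) → ∑ F f ≤ ∑ F g
    ∑-mono-≤ f≤g = sum-mono-≤ λ i → f≤g (element i)

    ∑-nonNeg : (f : X → Carrier) → (∀ s → 0# ≤ f s) → 0# ≤ ∑ F f
    ∑-nonNeg f f≥0 = sum-nonNeg {f = λ i → f (element i)} λ i → f≥0 (element i)

    *-distribˡ-∑ : ∀ r (f : X → Carrier) → r * ∑ F f ≈ ∑ F λ s → r * f s
    *-distribˡ-∑ r f = *-distribˡ-sum r λ i → f (element i)

    *-distribʳ-∑ : ∀ r (f : X → Carrier) → ∑ F f * r ≈ ∑ F λ s → f s * r
    *-distribʳ-∑ r f = *-distribʳ-sum r λ i → f (element i)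

    term≤∑ : (f : X → Carrier) → (∀ s → 0# ≤ f s) → ∀ s → f s ≤ ∑ F f
    term≤∑ f f≥0 s = ≡.subst (λ t → f t ≤ ∑ F f) (Inverse.strictlyInverseˡ enumeration s)
      (term≤sum {f = λ i → f (element i)} (λ i → f≥0 (element i)) (Inverse.from enumeration s))

  module _ {x} {X₁ X₂ : Set x} (F₁ : Finite X₁) (F₂ : Finite X₂) where

    -- The enumeration of the product decodes an index by `remQuot`, which undoes `combine`.
    ∑-×-finite : (f : X₁ × X₂ → Carrier) →
                 ∑ (F₁ ×-finite F₂) f ≈ ∑ F₁ λ x₁ → ∑ F₂ λ x₂ → f (x₁ , x₂)
    ∑-×-finite f = trans (sum-combine (Finite.size F₁) _)
      (reflexive (sum-cong-≗ λ i → sum-cong-≗ λ j →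
        ≡.cong (λ (i , j) → f (Finite.element F₁ i , Finite.element F₂ j)) (remQuot-combine i j)))

    ∑-×-finite-* : (f₁ : X₁ → Carrier) (f₂ : X₂ → Carrier) →
                   (∑ (F₁ ×-finite F₂) λ (x₁ , x₂) → f₁ x₁ * f₂ x₂) ≈ ∑ F₁ f₁ * ∑ F₂ f₂
    ∑-×-finite-* f₁ f₂ = begin-equality
      (∑ (F₁ ×-finite F₂) λ (x₁ , x₂) → f₁ x₁ * f₂ x₂)   ≈⟨ ∑-×-finite (λ (x₁ , x₂) → f₁ x₁ * f₂ x₂) ⟩
      (∑ F₁ λ x₁ → ∑ F₂ λ x₂ → f₁ x₁ * f₂ x₂)            ≈⟨ ∑-cong F₁ (λ x₁ → *-distribˡ-∑ F₂ (f₁ x₁) f₂) ⟨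
      (∑ F₁ λ x₁ → f₁ x₁ * ∑ F₂ f₂)                      ≈⟨ *-distribʳ-∑ F₁ (∑ F₂ f₂) f₁ ⟨
      ∑ F₁ f₁ * ∑ F₂ f₂                                  ∎

  -- Logarithms and signs in the extended reals

  log±-positive : ∀ {r} → Positive r → log± [ r ] ≡ [ log₂ r ]
  log±-positive {r} r>0 with r ≤? 0#
  ... | yes r≤0 = contradiction r≤0 r>0
  ... | no  _   = ≡.refl

  l+w≤a+b⇒-a-b+l≤-w : ∀ {l w a b} → l + w ≤ a + b → - a - b + l ≤ - w
  l+w≤a+b⇒-a-b+l≤-w {l} {w} {a} {b} l+w≤a+b = +-cancelʳ-≤ (a + b + w) (begin
    -- Adding a + b + w to both sides clears all the negatives.
    - a - b + l + (a + b + w)           ≈⟨ solve 6 (λ a a′ b b′ l w → a′ :+ b′ :+ l :+ (a :+ b :+ w) :=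
                                             a′ :+ a :+ (b′ :+ b) :+ (l :+ w)) refl a (- a) b (- b) l w ⟩
    - a + a + (- b + b) + (l + w)       ≈⟨ +-congʳ (+-cong (-‿inverseˡ a) (-‿inverseˡ b)) ⟩
    0# + 0# + (l + w)                   ≈⟨ +-congʳ (trans (+-identityˡ 0#) (sym (-‿inverseˡ w))) ⟩
    - w + w + (l + w)                   ≤⟨ +-monoʳ-≤ (- w + w) l+w≤a+b ⟩
    - w + w + (a + b)                   ≈⟨ solve 4 (λ a b w w′ → w′ :+ w :+ (a :+ b) :=
                                             w′ :+ (a :+ b :+ w)) refl a b w (- w) ⟩
    - w + (a + b + w)                   ∎)

  ∑-gain-nonNeg : ∀ {w x} {W : Set w} {X : Set x} (F : Finite X) (h : Gain W X) {p : X → Carrier} →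
                  (∀ s → 0# ≤ p s) → ∀ u → 0# ≤ ∑ F λ s → p s * gain h u s
  ∑-gain-nonNeg F h p≥0 u = ∑-nonNeg F _ λ s → *-nonNeg (p≥0 s) (gain≥0 h u s)

  -- The case `infinite` is there because `minRatio u` is `⊤±` when `S u` is empty. Matching on this
  -- type rules out `⊥±`.
  data Positive± : Pred (Carrier ±) (c Level.⊔ ℓ) where
    finite   : ∀ {r} → Positive r → Positive± [ r ]
    infinite : Positive± ⊤±

  -- Ratios, their minimum and the vulnerabilities

  module _ {w x} {X₁ X₂ : Set x} (F₁ : Finite X₁) (F₂ : Finite X₂) {W₁ W₂ : Set w}
           (g₁ : Gain W₁ X₁) (g₂ : Gain W₂ X₂) (g : Gain (W₁ × W₂) (X₁ × X₂))
           (π : Prior (F₁ ×-finite F₂)) where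

    private
      F  = F₁ ×-finite F₂
      π₁ = marginal₁ F₁ F₂ π
      π₂ = marginal₂ F₁ F₂ π

      numerator : W₁ × W₂ → X₁ × X₂ → Carrier
      numerator (w₁ , w₂) (x₁ , x₂) = π₁ x₁ * gain g₁ w₁ x₁ * (π₂ x₂ * gain g₂ w₂ x₂)

    marginal₁-nonNeg : ∀ x₁ → 0# ≤ π₁ x₁
    marginal₁-nonNeg x₁ = ∑-nonNeg F₂ (λ x₂ → mass π (x₁ , x₂)) λ x₂ → nonNeg π (x₁ , x₂)

    marginal₂-nonNeg : ∀ x₂ → 0# ≤ π₂ x₂
    marginal₂-nonNeg x₂ = ∑-nonNeg F₁ (λ x₁ → mass π (x₁ , x₂)) λ x₁ → nonNeg π (x₁ , x₂)

    numerator-nonNeg : ∀ u s → 0# ≤ numerator u s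
    numerator-nonNeg (w₁ , w₂) (x₁ , x₂) =
      *-nonNeg (*-nonNeg (marginal₁-nonNeg x₁) (gain≥0 g₁ w₁ x₁))
               (*-nonNeg (marginal₂-nonNeg x₂) (gain≥0 g₂ w₂ x₂))

    denominator-positive : ∀ {u s} → S F₁ F₂ π g₁ g₂ g u s → Positive (mass π s * gain g u s)
    denominator-positive {u} {s} = ≥0∧≉0⇒positive (*-nonNeg (nonNeg π s) (gain≥0 g u s))

    -- On `S` the mass is positive, hence so are both marginals, which dominate it; and a nonzero
    -- joint gain forces both single gains to be nonzero.
    ratio-positive : IsJointGain g₁ g₂ g → ∀ {u s} → S F₁ F₂ π g₁ g₂ g u s →
                     Positive (ratio F₁ F₂ π g₁ g₂ g u s)
    ratio-positive joint {w₁ , w₂} {x₁ , x₂} πg≉0 =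
      *-positive (*-positive (*-positive π₁>0 g₁>0) (*-positive π₂>0 g₂>0))
                 (⁻¹-positive (denominator-positive πg≉0))
      where
      π>0 : Positive (mass π (x₁ , x₂))
      π>0 = ≥0∧≉0⇒positive (nonNeg π _) (*-≉0ˡ πg≉0)

      π₁>0 : Positive (π₁ x₁)
      π₁>0 = positive-mono (term≤∑ F₂ (λ x₂ → mass π (x₁ , x₂)) (λ x₂ → nonNeg π (x₁ , x₂)) x₂) π>0

      π₂>0 : Positive (π₂ x₂)
      π₂>0 = positive-mono (term≤∑ F₁ (λ x₁ → mass π (x₁ , x₂)) (λ x₁ → nonNeg π (x₁ , x₂)) x₁) π>0

      g₁g₂≉0 : ¬ gain g₁ w₁ x₁ * gain g₂ w₂ x₂ ≈ 0#
      g₁g₂≉0 = *-≉0ʳ πg≉0 ∘ Equivalence.from (joint w₁ w₂ x₁ x₂)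

      g₁>0 = ≥0∧≉0⇒positive (gain≥0 g₁ w₁ x₁) (*-≉0ˡ g₁g₂≉0)
      g₂>0 = ≥0∧≉0⇒positive (gain≥0 g₂ w₂ x₂) (*-≉0ʳ g₁g₂≉0)

    -- The minimum is either the default `⊤±` or one of the listed ratios, so what holds for all of
    -- these holds for it.
    minRatio-positive : IsJointGain g₁ g₂ g → ∀ u → Positive± (minRatio F₁ F₂ π g₁ g₂ g u)
    minRatio-positive joint u = argmin-all id {P = Positive±} infinite
      (All.map⁺ (All.map (λ πg≉0 → finite (ratio-positive joint πg≉0))
        (All.all-filter (S? F₁ F₂ π g₁ g₂ g u) (Finite.elements F))))
      where open Extrema totalOrder±

    minRatio≤ratio : ∀ u s → S F₁ F₂ π g₁ g₂ g u s →
                     minRatio F₁ F₂ π g₁ g₂ g u ≤± [ ratio F₁ F₂ π g₁ g₂ g u s ]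
    minRatio≤ratio u s s∈S = All.lookup (min≤xs ⊤± _)
      (∈-map⁺ _ (∈-filter⁺ (S? F₁ F₂ π g₁ g₂ g u) (∈-elements F s) s∈S))
      where open Extrema totalOrder±

    -- An infinite minimum means that `S u` is empty, since a member would have a finite ratio above
    -- it; so every term vanishes.
    ⊤≤minRatio⇒∑≈0 : ∀ u → ⊤± ≤± minRatio F₁ F₂ π g₁ g₂ g u →
                        (∑ F λ s → mass π s * gain g u s) ≈ 0#
    ⊤≤minRatio⇒∑≈0 u ⊤≤min = ∑-zero F term≈0
      where
      term≈0 : ∀ s → mass π s * gain g u s ≈ 0#
      term≈0 s = decidable-stable (_ ≟ _) λ πg≉0 →
        case ≤±-trans ≤-trans ⊤≤min (minRatio≤ratio u s πg≉0) of λ ()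

    minRatio-*-∑≤ : ∀ {m} w₁ w₂ → [ m ] ≤± minRatio F₁ F₂ π g₁ g₂ g (w₁ , w₂) →
      m * (∑ F λ s → mass π s * gain g (w₁ , w₂) s) ≤
      (∑ F₁ λ x₁ → π₁ x₁ * gain g₁ w₁ x₁) * (∑ F₂ λ x₂ → π₂ x₂ * gain g₂ w₂ x₂)
    minRatio-*-∑≤ {m} w₁ w₂ m≤min = begin
      m * (∑ F λ s → mass π s * gain g u s)       ≈⟨ *-distribˡ-∑ F m (λ s → mass π s * gain g u s) ⟩
      (∑ F λ s → m * (mass π s * gain g u s))     ≤⟨ ∑-mono-≤ F term≤ ⟩
      -- The numerator is a function of x₁ times a function of x₂, so its sum factorises.
      ∑ F (numerator u)                           ≈⟨ ∑-×-finite-* F₁ F₂ (λ x₁ → π₁ x₁ * gain g₁ w₁ x₁)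
                                                                         (λ x₂ → π₂ x₂ * gain g₂ w₂ x₂) ⟩
      (∑ F₁ λ x₁ → π₁ x₁ * gain g₁ w₁ x₁) * (∑ F₂ λ x₂ → π₂ x₂ * gain g₂ w₂ x₂) ∎
      where
      u = w₁ , w₂

      term≤ : ∀ s → m * (mass π s * gain g u s) ≤ numerator u s
      term≤ s with mass π s * gain g u s ≟ 0#
      ... | yes πg≈0 = begin
        m * (mass π s * gain g u s) ≈⟨ *-congˡ πg≈0 ⟩
        m * 0#                      ≈⟨ zeroʳ m ⟩
        0#                          ≤⟨ numerator-nonNeg u s ⟩
        numerator u s               ∎
      ... | no  πg≉0 = x≤y÷z⇒xz≤y (denominator-positive πg≉0)
        ([≤]-injective (≤±-trans ≤-trans m≤min (minRatio≤ratio u s πg≉0)))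

    -- The components of an optimal joint guess may fail to be optimal for `g₁` and `g₂`, but each
    -- achieves at most the corresponding vulnerability.
    minRatio-*-V≤V₁*V₂ :
      (V  : Vulnerability F g (mass π)) (V₁ : Vulnerability F₁ g₁ π₁) (V₂ : Vulnerability F₂ g₂ π₂) →
      ∀ {m} → [ m ] ≤± minRatio F₁ F₂ π g₁ g₂ g (Maximum.argmax (Vulnerability.maximum V)) →
      m * Vulnerability.value V ≤ Vulnerability.value V₁ * Vulnerability.value V₂
    minRatio-*-V≤V₁*V₂ V V₁ V₂ m≤min = ≤-trans (minRatio-*-∑≤ w₁ w₂ m≤min)
      (*-mono-≤ (∑-gain-nonNeg F₁ g₁ marginal₁-nonNeg _) (∑-gain-nonNeg F₂ g₂ marginal₂-nonNeg w₂)
                (Maximum.maximal (maximum V₁) w₁) (Maximum.maximal (maximum V₂) w₂))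
      where
      open Vulnerability using (maximum)
      w₁ = proj₁ (Maximum.argmax (maximum V))
      w₂ = proj₂ (Maximum.argmax (maximum V))

    entropy-bound : IsJointGain g₁ g₂ g →
      (V  : Vulnerability F g (mass π)) (V₁ : Vulnerability F₁ g₁ π₁) (V₂ : Vulnerability F₂ g₂ π₂)
      (M  : M-min F₁ F₂ π g₁ g₂ g) →
      (entropy V₁ +± entropy V₂ +± log± (Maximum.value M)) ≤± entropy V
    entropy-bound joint V V₁ V₂ M
      with Vulnerability.value V ≤? 0#
    -- Here the joint entropy is `⊤±`, above everything.
    ... | yes v≤0 = (entropy V₁ +± entropy V₂ +± log± (Maximum.value M)) ≤⊤±
    ... | no  v>0
      with Maximum.value M
         | minRatio-positive joint (Maximum.argmax M)
         | Maximum.maximal M (Maximum.argmax (Vulnerability.maximum V))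
    -- The optimal joint guess would have an infinite `minRatio`, making the joint vulnerability 0.
    ... | ⊤± | infinite | ⊤≤min = contradiction (≤-reflexive (⊤≤minRatio⇒∑≈0 _ ⊤≤min)) v>0
    ... | [ m ] | finite m>0 | m≤min = goal
      where
      v  = Vulnerability.value V
      v₁ = Vulnerability.value V₁
      v₂ = Vulnerability.value V₂

      mv≤v₁v₂ : m * v ≤ v₁ * v₂
      mv≤v₁v₂ = minRatio-*-V≤V₁*V₂ V V₁ V₂ m≤min

      -- The product v₁ v₂ is at least m v > 0, so neither marginal entropy is infinite and the
      -- claim becomes one about reals.
      factors : Positive v₁ × Positive v₂
      factors = positive-factors (∑-gain-nonNeg F₁ g₁ marginal₁-nonNeg _) (∑-gain-nonNeg F₂ g₂ marginal₂-nonNeg _)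
        (positive-mono mv≤v₁v₂ (*-positive m>0 v>0))

      v₁>0 = proj₁ factors
      v₂>0 = proj₂ factors

      bound : - log₂ v₁ - log₂ v₂ + log₂ m ≤ - log₂ v
      bound = l+w≤a+b⇒-a-b+l≤-w (log₂-product-≤ m>0 v>0 v₁>0 v₂>0 mv≤v₁v₂)

      goal : ((-± log± [ v₁ ]) +± (-± log± [ v₂ ]) +± log± [ m ]) ≤± [ - log₂ v ]
      goal rewrite log±-positive v₁>0 | log±-positive v₂>0 | log±-positive m>0 = ≤±[ bound ]

proposition3p5 : ∀ {c ℓ w x} (ℛ : RealNumbers c ℓ) →
    let open Entropy ℛ in
    {X₁ X₂ : Set x} (F₁ : Finite X₁) (F₂ : Finite X₂)
    {W₁ W₂ : Set w}
    (g₁ : Gain W₁ X₁) (g₂ : Gain W₂ X₂)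
    (g : Gain (W₁ × W₂) (X₁ × X₂)) → IsJointGain g₁ g₂ g →
    (π  : Prior (F₁ ×-finite F₂))
    (V  : Vulnerability (F₁ ×-finite F₂) g (Prior.mass π))
    (V₁ : Vulnerability F₁ g₁ (marginal₁ F₁ F₂ π))
    (V₂ : Vulnerability F₂ g₂ (marginal₂ F₁ F₂ π))
    (M  : M-min F₁ F₂ π g₁ g₂ g) →
    (entropy V₁ +± entropy V₂ +± log± (Maximum.value M)) ≤± entropy V
proposition3p5 ℛ F₁ F₂ g₁ g₂ g joint π V V₁ V₂ M =
  VulnerabilityBound.entropy-bound ℛ F₁ F₂ g₁ g₂ g π joint V V₁ V₂ M
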